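{- Let $k\ge 1$ be an integer and let $G$ be a finite simple connected graph that is $k$-chromatic. Then $G$ contains at least $k^{k-2}$ spanning trees.
   Context: A graph is $k$-chromatic if it admits a proper vertex coloring using $k$ colors but does not admit one using $k-1$ colors, i.e. its chromatic number equals $k$. The spanning trees of $G$ are counted as distinct subgraphs of $G$ (equivalently, as distinct edge sets), not up to isomorphism. For $k=1$ the quantity $k^{k-2}$ is $1^{ -1}=1$. -}

module Defs where

open import Data.Bool.Base using (Bool; T)
open import Data.Fin.Base using (Fin)
open import Data.List.Base using (List; _∷_; _∷ʳ_; length)
open import Data.List.Relation.Unary.Linked using (Linked)
open import Data.List.Relation.Unary.Unique.Propositional using (Unique)
open import Data.Nat.Base using (ℕ; _≤_; _<_; _∸_)
open import Data.Product.Base using (Σ-syntax; ∃; _×_)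
open import Function.Definitions using (Injective)
open import Level using (0ℓ)
open import Relation.Binary.Construct.Closure.ReflexiveTransitive using (Star)
open import Relation.Binary.Core using (Rel)
open import Relation.Binary.Definitions using (Symmetric; Irreflexive)
open import Relation.Binary.PropositionalEquality.Core using (_≡_; _≢_)
open import Relation.Nullary.Negation.Core using (¬_)

record Graph (n : ℕ) : Set where
  field
    adj : Fin n → Fin n → Bool

  Adj : Rel (Fin n) 0ℓ
  Adj u v = T (adj u v)

  field
    symmetric   : Symmetric Adj
    irreflexive : Irreflexive _≡_ Adj

open Graph public using (adj; Adj)

-- Graphs on the same vertex set are identified when their edge sets agree;
-- the propositional equality of `Graph n` would also compare the proof fields.
infix 4 _≈_

_≈_ : ∀ {n} → Rel (Graph n) 0ℓ
G ≈ H = ∀ u v → adj G u v ≡ adj H u v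

Connected : ∀ {n} → Graph n → Set
Connected {n} G = 0 < n × (∀ u v → Star (Adj G) u v)

-- A cycle is given by its distinct vertices x ∷ xs in cyclic order.  The bound
-- on the length excludes walking back and forth along a single edge.
IsCycle : ∀ {n} → Graph n → Fin n → List (Fin n) → Set
IsCycle G x xs =
  3 ≤ length (x ∷ xs) × Unique (x ∷ xs) × Linked (Adj G) (x ∷ (xs ∷ʳ x))

Acyclic : ∀ {n} → Graph n → Set
Acyclic G = ∀ x xs → ¬ IsCycle G x xs

IsTree : ∀ {n} → Graph n → Set
IsTree G = Connected G × Acyclic G

-- A spanning subgraph of G has all the vertices of G, so it is again a graph
-- on `Fin n`.
_IsSpanningTreeOf_ : ∀ {n} → Graph n → Graph n → Set
H IsSpanningTreeOf G = (∀ u v → Adj H u v → Adj G u v) × IsTree H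

AtLeast_SpanningTreesIn_ : ∀ {n} → ℕ → Graph n → Set
AtLeast_SpanningTreesIn_ {n} m G =
  Σ[ t ∈ (Fin m → Graph n) ]
    (∀ i → t i IsSpanningTreeOf G) × Injective _≡_ _≈_ t

IsProperColouring : ∀ {n k} → Graph n → (Fin n → Fin k) → Set
IsProperColouring G c = ∀ u v → Adj G u v → c u ≢ c v

Colourable : ∀ {n} → ℕ → Graph n → Set
Colourable {n} k G = ∃ λ (c : Fin n → Fin k) → IsProperColouring G c

-- Meant for k ≥ 1, where k ∸ 1 is the true predecessor; no graph is
-- 0-chromatic in this sense.
Chromatic : ∀ {n} → ℕ → Graph n → Set
Chromatic k G = Colourable k G × ¬ Colourable (k ∸ 1) G

{-# OPTIONS --safe #-}
-- Let u and v be non-adjacent with a common neighbour w, and let G′ be G with u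
-- and v identified to x and parallel edges merged.  A colouring of G′ pulls back
-- to G, and G has at least as many spanning trees as G′: lift a spanning tree of
-- G′ to a forest F of G, taking the edges from x to common neighbours to u.  Since
-- F has two components, one with u and one with v, adding vw or uw, whichever
-- joins them, gives a tree.  It determines F: the edge vw is never in F, and uw is
-- in F only if the tree contains vw as well.
-- A connected graph without such u and v is complete.  So the process ends
-- in some complete graph on n ≥ k vertices, which by Prüfer codes has n ^ (n ∸ 2)
-- spanning trees.
module Submission where

open import Defs
open import Data.Bool.Base using (T)
open import Data.Bool.Properties using (T?; ⇔→≡; T-≡)
open import Data.Fin.Base
  using (Fin; zero; suc; punchIn; punchOut; Fin′; inject≤; inject; finToFun; funToFin; combine; fromℕ<)
import Data.Fin.Base as Fin
open import Data.Fin.Properties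
  using (_≟_; any?; toℕ-injective; toℕ-inject; toℕ-fromℕ<; punchInᵢ≢i; punchIn-injective;
         punchIn-punchOut; punchOut-punchIn; punchOut-injective; punchOut-cong;
         inject≤-injective; funToFin-finToFin; injective⇒≤; ¬∀⟶∃¬-smallest; <-cmp)
open import Data.List.Base using ([]; _∷_; _∷ʳ_)
open import Data.List.Relation.Unary.All using (All; []; _∷_)
open import Data.List.Relation.Unary.AllPairs using ([]; _∷_)
open import Data.List.Relation.Unary.Linked using (Linked; [-]; _∷_)
open import Data.Nat.Base using (ℕ; zero; suc; _≤_; _<_; _∸_; _^_; s≤s; z≤n; _+_)
open import Data.Nat.Properties using (<⇒≱; ≰⇒>; ≤-refl; ≤-trans; m≤n⇒m≤1+n; ^-monoˡ-≤; ^-monoʳ-≤; ∸-monoˡ-≤)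
open import Data.Product.Base using (Σ-syntax; ∃; ∃₂; _×_; _,_; proj₁; proj₂)
open import Data.Sum.Base using (_⊎_; inj₁; inj₂; swap; [_,_]′)
open import Function.Base using (_∘_; id)
open import Function.Bundles using (mk⇔; Equivalence)
open import Function.Definitions using (Injective)
open import Level using (0ℓ)
open import Relation.Binary.Construct.Closure.ReflexiveTransitive
  using (Star; ε; _◅_; _◅◅_; gmap; map; reverse; return)
open import Relation.Binary.Core using (Rel; _⇒_)
open import Relation.Binary.Definitions using (Symmetric; Irreflexive; Decidable; tri<; tri≈; tri>)
open import Relation.Binary.PropositionalEquality using (_≡_; _≢_; refl; sym; trans; cong; cong₂; subst; subst₂)
open import Relation.Nullary using (¬_; Dec; yes; no; contradiction; ¬?)
open import Relation.Nullary.Decidable using (_×-dec_; _⊎-dec_; ⌊_⌋; toWitness; fromWitness)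

-- Trees as connected graphs in which every edge is a bridge

SameEdge : ∀ {A : Set} → A → A → A → A → Set
SameEdge a b c d = (a ≡ c × b ≡ d) ⊎ (a ≡ d × b ≡ c)

Avoiding : ∀ {A : Set} → Rel A 0ℓ → A → A → Rel A 0ℓ
Avoiding R a b s t = R s t × ¬ SameEdge s t a b

EdgesAreBridges : ∀ {A : Set} → Rel A 0ℓ → Set
EdgesAreBridges R = ∀ {a b} → R a b → ¬ Star (Avoiding R a b) a b

-- A tree here is a connected graph all of whose edges are bridges.  Unlike the
-- absence of cycles, this is easily transported along maps of vertices.
record Tree {A : Set} (R : Rel A 0ℓ) : Set where
  field
    connected : ∀ u v → Star R u v
    bridges   : EdgesAreBridges R

open Tree

avoiding-symmetric : ∀ {A : Set} {R : Rel A 0ℓ} {a b} → Symmetric R → Symmetric (Avoiding R a b)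
avoiding-symmetric R-sym (st , ¬ab) = R-sym st , λ where
  (inj₁ (p , q)) → ¬ab (inj₂ (q , p))
  (inj₂ (p , q)) → ¬ab (inj₁ (q , p))

-- The cycle without its edge `xy` is a walk from `y` round to `x`. As the vertices are distinct, no
-- step of it is `xy` again.
bridges⇒acyclic : ∀ {n} (G : Graph n) → EdgesAreBridges (Adj G) → Acyclic G
bridges⇒acyclic G _ x [] (s≤s () , _)
bridges⇒acyclic G _ x (y ∷ []) (s≤s (s≤s ()) , _)
bridges⇒acyclic G bridges x (y ∷ z ∷ zs)
  (_ , (x≢y ∷ x≢z ∷ x∉zs) ∷ (y≢z ∷ y∉zs) ∷ _ , xy ∷ yz ∷ path) =
  bridges xy (reverse (avoiding-symmetric (Graph.symmetric G)) (first ◅ rest z zs x≢z y≢z x∉zs y∉zs path))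
  where
  first : Avoiding (Adj G) x y y z
  first = yz , λ where
    (inj₁ (y≡x , _)) → x≢y (sym y≡x)
    (inj₂ (_ , z≡x)) → x≢z (sym z≡x)

  step : ∀ {z t} → x ≢ z → y ≢ z → Adj G z t → Avoiding (Adj G) x y z t
  step x≢z y≢z zt = zt , λ where
    (inj₁ (z≡x , _)) → x≢z (sym z≡x)
    (inj₂ (z≡y , _)) → y≢z (sym z≡y)

  rest : ∀ z zs → x ≢ z → y ≢ z → All (x ≢_) zs → All (y ≢_) zs →
         Linked (Adj G) (z ∷ (zs ∷ʳ x)) → Star (Avoiding (Adj G) x y) z x
  rest z []       x≢z y≢z []           []           (zx ∷ [-])  = return (step x≢z y≢z zx)
  rest z (t ∷ ts) x≢z y≢z (x≢t ∷ x∉ts) (y≢t ∷ y∉ts) (zt ∷ path) =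
    step x≢z y≢z zt ◅ rest t ts x≢t y≢t x∉ts y∉ts path

Joined : ∀ {A : Set} → Rel A 0ℓ → A → A → Rel A 0ℓ
Joined R q w a b = R a b ⊎ SameEdge a b q w

joined-symmetric : ∀ {A : Set} {R : Rel A 0ℓ} {q w} → Symmetric R → Symmetric (Joined R q w)
joined-symmetric R-sym (inj₁ e)              = inj₁ (R-sym e)
joined-symmetric R-sym (inj₂ (inj₁ (p , r))) = inj₂ (inj₂ (r , p))
joined-symmetric R-sym (inj₂ (inj₂ (p , r))) = inj₂ (inj₁ (r , p))

-- Consecutive crossings of `qw` in opposite directions cancel, and everything between two crossings
-- in the same direction can be cut out. So at most one crossing remains.
joined-walk : ∀ {A : Set} {R : Rel A 0ℓ} {q w s t} → Star (Joined R q w) s t →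
              Star R s t ⊎ (Star R s q × Star R w t) ⊎ (Star R s w × Star R q t)
joined-walk ε = inj₁ ε
joined-walk (inj₁ e ◅ walk) with joined-walk walk
... | inj₁ st                = inj₁ (e ◅ st)
... | inj₂ (inj₁ (sq , wt)) = inj₂ (inj₁ (e ◅ sq , wt))
... | inj₂ (inj₂ (sw , qt)) = inj₂ (inj₂ (e ◅ sw , qt))
joined-walk (inj₂ (inj₁ (refl , refl)) ◅ walk) with joined-walk walk
... | inj₁ wt               = inj₂ (inj₁ (ε , wt))
... | inj₂ (inj₁ (_ , wt)) = inj₂ (inj₁ (ε , wt))
... | inj₂ (inj₂ (_ , qt)) = inj₁ qt
joined-walk (inj₂ (inj₂ (refl , refl)) ◅ walk) with joined-walk walk
... | inj₁ qt               = inj₂ (inj₂ (ε , qt))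
... | inj₂ (inj₁ (_ , wt)) = inj₁ wt
... | inj₂ (inj₂ (_ , qt)) = inj₂ (inj₂ (ε , qt))

-- A walk bypassing `qw` lies in `R`, against separation. A walk bypassing an old edge `ab` must,
-- once shortened, cross `qw` exactly once, since `ab` is a bridge of `R`; its two halves together
-- with `ab` then connect `q` to `w` inside `R`.
join-tree : ∀ {A : Set} {R : Rel A 0ℓ} {q w} → Symmetric R → EdgesAreBridges R →
            (∀ z → Star R z w ⊎ Star R z q) → ¬ Star R q w → Tree (Joined R q w)
join-tree {A} {R} {q} {w} R-sym R-bridges covered separated = record
  { connected = λ a b → to-w a ◅◅ reverse (joined-symmetric R-sym) (to-w b)
  ; bridges   = bridge
  }
  where
  to-w : ∀ z → Star (Joined R q w) z w
  to-w z with covered z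
  ... | inj₁ zw = map inj₁ zw
  ... | inj₂ zq = map inj₁ zq ◅◅ return (inj₂ (inj₁ (refl , refl)))

  back : ∀ {s t} → Star R s t → Star R t s
  back = reverse R-sym

  avoid-join : ∀ {a b} → Avoiding (Joined R q w) a b ⇒ Joined (Avoiding R a b) q w
  avoid-join (inj₁ e  , ¬ab) = inj₁ (e , ¬ab)
  avoid-join (inj₂ qw , _)   = inj₂ qw

  drop-join : Avoiding (Joined R q w) q w ⇒ R
  drop-join (inj₁ e  , _)   = e
  drop-join (inj₂ qw , ¬qw) = contradiction qw ¬qw

  drop-join′ : Avoiding (Joined R q w) w q ⇒ R
  drop-join′ (inj₁ e , _)   = e
  drop-join′ (inj₂ e , ¬wq) = contradiction (swap e) ¬wq

  bridge : EdgesAreBridges (Joined R q w)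
  bridge (inj₂ (inj₁ (refl , refl))) walk = separated (map drop-join walk)
  bridge (inj₂ (inj₂ (refl , refl))) walk = separated (back (map drop-join′ walk))
  bridge (inj₁ ab) walk with joined-walk (map avoid-join walk)
  ... | inj₁ a⇝b                = R-bridges ab a⇝b
  ... | inj₂ (inj₁ (aq , wb)) = separated (back (map proj₁ aq) ◅◅ ab ◅ back (map proj₁ wb))
  ... | inj₂ (inj₂ (aw , qb)) = separated (map proj₁ qb ◅◅ R-sym ab ◅ map proj₁ aw)

-- Graphs from decidable relations, and families of distinct trees

sameEdge? : ∀ {n} (a b c d : Fin n) → Dec (SameEdge a b c d)
sameEdge? a b c d = (a ≟ c ×-dec b ≟ d) ⊎-dec (a ≟ d ×-dec b ≟ c)

joined-irreflexive : ∀ {A : Set} {R : Rel A 0ℓ} {q w} → q ≢ w → Irreflexive _≡_ R → Irreflexive _≡_ (Joined R q w)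
joined-irreflexive q≢w R-irr a≡b  (inj₁ e) = R-irr a≡b e
joined-irreflexive q≢w R-irr refl (inj₂ (inj₁ (p , r))) = q≢w (trans (sym p) r)
joined-irreflexive q≢w R-irr refl (inj₂ (inj₂ (p , r))) = q≢w (trans (sym r) p)

adj? : ∀ {n} (G : Graph n) → Decidable (Adj G)
adj? G u v = T? (adj G u v)

≈-intro : ∀ {n} {G H : Graph n} → Adj G ⇒ Adj H → Adj H ⇒ Adj G → G ≈ H
≈-intro G⇒H H⇒G u v = ⇔→≡ (mk⇔
  (Equivalence.to T-≡ ∘ G⇒H ∘ Equivalence.from T-≡)
  (Equivalence.to T-≡ ∘ H⇒G ∘ Equivalence.from T-≡))

≈-sym : ∀ {n} {G H : Graph n} → G ≈ H → H ≈ G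
≈-sym G≈H u v = sym (G≈H u v)

≈⇒adj : ∀ {n} {G H : Graph n} → G ≈ H → Adj G ⇒ Adj H
≈⇒adj G≈H {u} {v} = subst T (G≈H u v)

module _ {n} {R : Rel (Fin n) 0ℓ} (R? : Decidable R) (R-sym : Symmetric R) (R-irr : Irreflexive _≡_ R) where

  -- Later arguments go through `fromRel⁺` and `fromRel⁻` only, never through the Boolean values.
  opaque
    fromRel : Graph n
    fromRel = record
      { adj         = λ u v → ⌊ R? u v ⌋
      ; symmetric   = λ e → fromWitness (R-sym (toWitness e))
      ; irreflexive = λ u≡v e → R-irr u≡v (toWitness e)
      }

    fromRel⁺ : R ⇒ Adj fromRel
    fromRel⁺ = fromWitness

    fromRel⁻ : Adj fromRel ⇒ R
    fromRel⁻ = toWitness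

tree-resp : ∀ {A : Set} {R S : Rel A 0ℓ} → R ⇒ S → S ⇒ R → Tree R → Tree S
tree-resp R⇒S S⇒R tree = record
  { connected = λ u v → map R⇒S (connected tree u v)
  ; bridges   = λ e walk → bridges tree (S⇒R e) (map (λ (e , ¬ab) → S⇒R e , ¬ab) walk)
  }

-- Working form of `AtLeast_SpanningTreesIn_`: trees are given by bridges, and nonemptiness of the
-- vertex set is postponed to `atLeastTrees⇒spanning`.
AtLeastTrees : ∀ {n} → ℕ → Graph n → Set
AtLeastTrees {n} m G =
  Σ[ t ∈ (Fin m → Graph n) ] (∀ i → Adj (t i) ⇒ Adj G × Tree (Adj (t i))) × Injective _≡_ _≈_ t

atLeastTrees⇒spanning : ∀ {m n} {G : Graph n} → 0 < n → AtLeastTrees m G → AtLeast m SpanningTreesIn G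
atLeastTrees⇒spanning 0<n (t , ok , inj) =
    t
  , (λ i → (λ _ _ → proj₁ (ok i))
         , (0<n , connected (proj₂ (ok i)))
         , bridges⇒acyclic (t i) (bridges (proj₂ (ok i))))
  , inj

atLeast-mono : ∀ {m m′ n} {G : Graph n} → m ≤ m′ → AtLeastTrees m′ G → AtLeastTrees m G
atLeast-mono m≤m′ (t , ok , inj) =
  (λ i → t (inject≤ i m≤m′)) , (λ i → ok (inject≤ i m≤m′)) , λ eq → inject≤-injective m≤m′ m≤m′ _ _ (inj eq)

-- Identifying two vertices with a common neighbour, and lifting trees back

-- The edges from x = π u to the common neighbours of u and v can be lifted
-- either to u or to v; K keeps those at u, which makes edge lifts unique.
module Fold {n m} (G : Graph n) (π : Fin n → Fin m) (π-surjective : ∀ i → ∃ λ a → π a ≡ i)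
            {u v w : Fin n} (πu≡πv : π u ≡ π v)
            (π-kernel : ∀ {a b} → π a ≡ π b → a ≡ b ⊎ SameEdge a b u v)
            (u≢v : u ≢ v) (¬uv : ¬ Adj G u v) (uw : Adj G u w) (vw : Adj G v w) where

  private
    G-sym : Symmetric (Adj G)
    G-sym = Graph.symmetric G

    G-irr : Irreflexive _≡_ (Adj G)
    G-irr = Graph.irreflexive G

  Image : Rel (Fin m) 0ℓ
  Image i j = ∃₂ λ a b → π a ≡ i × π b ≡ j × Adj G a b

  image? : Decidable Image
  image? i j = any? λ a → any? λ b → π a ≟ i ×-dec π b ≟ j ×-dec adj? G a b

  image-symmetric : Symmetric Image
  image-symmetric (a , b , πa , πb , ab) = b , a , πb , πa , G-sym ab

  -- Non-adjacency of `u` and `v` enters here: an edge inside a fibre of `π` would be a loop or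
  -- `uv`.
  image-irreflexive : Irreflexive _≡_ Image
  image-irreflexive refl (a , b , refl , πb , ab) with π-kernel πb
  ... | inj₁ b≡a                  = G-irr (sym b≡a) ab
  ... | inj₂ (inj₁ (refl , refl)) = ¬uv (G-sym ab)
  ... | inj₂ (inj₂ (refl , refl)) = ¬uv ab

  folded : Graph m
  folded = fromRel image? image-symmetric image-irreflexive

  fold-adj : ∀ {a b} → Adj G a b → Adj folded (π a) (π b)
  fold-adj ab = fromRel⁺ image? image-symmetric image-irreflexive (_ , _ , refl , refl , ab)

  folded-connected : (∀ a b → Star (Adj G) a b) → ∀ i j → Star (Adj folded) i j
  folded-connected G-conn i j with π-surjective i | π-surjective j
  ... | a , refl | b , refl = gmap π fold-adj (G-conn a b)

  folded-colourable : ∀ {k} → Colourable k folded → Colourable k G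
  folded-colourable (c , proper) = c ∘ π , λ a b ab → proper (π a) (π b) (fold-adj ab)

  K : Rel (Fin n) 0ℓ
  K a b = Adj G a b × ¬ (a ≡ v × Adj G u b) × ¬ (b ≡ v × Adj G u a)

  K? : Decidable K
  K? a b = adj? G a b ×-dec ¬? (a ≟ v ×-dec adj? G u b) ×-dec ¬? (b ≟ v ×-dec adj? G u a)

  K-symmetric : Symmetric K
  K-symmetric (ab , ¬a , ¬b) = G-sym ab , ¬b , ¬a

  ub∈K : ∀ {b} → Adj G u b → K u b
  ub∈K ub = ub , (λ (u≡v , _) → u≢v u≡v) , (λ (b≡v , _) → ¬uv (subst (Adj G u) b≡v ub))

  -- An edge of `G` that `K` discards joins `v` to a neighbour of `u`. Moving its end from `v` to
  -- `u` keeps the image and lands in `K`.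
  K-lift : ∀ {i j} → Adj folded i j → ∃₂ λ a b → π a ≡ i × π b ≡ j × K a b
  K-lift ij with fromRel⁻ image? image-symmetric image-irreflexive ij
  ... | a , b , πa , πb , ab with a ≟ v ×-dec adj? G u b | b ≟ v ×-dec adj? G u a
  ... | yes (refl , ub) | _               = u , b , trans πu≡πv πa , πb , ub∈K ub
  ... | no _            | yes (refl , ua) = a , u , πa , trans πu≡πv πb , K-symmetric (ub∈K ua)
  ... | no ¬a           | no ¬b           = a , b , πa , πb , ab , ¬a , ¬b

  private
    -- If `b` and `b′` coincide, they are a common neighbour, whose edge to `v` is not in `K`.
    -- Otherwise `b` is `u` or `v`, and `ub` is a loop or the missing edge `uv`.
    K-unique-u : ∀ {b b′} → K u b → K v b′ → ¬ (π b ≡ π b′)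
    K-unique-u (ub , _) (vb′ , ¬both , _) πb with π-kernel πb
    ... | inj₁ refl                 = ¬both (refl , ub)
    ... | inj₂ (inj₁ (refl , refl)) = G-irr refl ub
    ... | inj₂ (inj₂ (refl , refl)) = ¬uv ub

  K-unique-source : ∀ {a b a′ b′} → K a b → K a′ b′ → π a ≡ π a′ → π b ≡ π b′ → a ≡ a′
  K-unique-source ab ab′ πa πb with π-kernel πa
  ... | inj₁ a≡a′                 = a≡a′
  ... | inj₂ (inj₁ (refl , refl)) = contradiction πb (K-unique-u ab ab′)
  ... | inj₂ (inj₂ (refl , refl)) = contradiction (sym πb) (K-unique-u ab′ ab)

  K-unique : ∀ {a b a′ b′} → K a b → K a′ b′ → π a ≡ π a′ → π b ≡ π b′ → a ≡ a′ × b ≡ b′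
  K-unique ab ab′ πa πb =
    K-unique-source ab ab′ πa πb , K-unique-source (K-symmetric ab) (K-symmetric ab′) πb πa

  Lifted : Graph m → Rel (Fin n) 0ℓ
  Lifted T a b = K a b × Adj T (π a) (π b)

  lift-edge : ∀ T → Adj T ⇒ Adj folded →
              ∀ {i j} → Adj T i j → ∃₂ λ a b → π a ≡ i × π b ≡ j × Lifted T a b
  lift-edge T T⊆G ij with K-lift (T⊆G ij)
  ... | a , b , refl , refl , ab = a , b , refl , refl , ab , ij

  module Unfold (T : Graph m) (T⊆G : Adj T ⇒ Adj folded) (T-tree : Tree (Adj T)) where

    F : Rel (Fin n) 0ℓ
    F = Lifted T

    F-symmetric : Symmetric F
    F-symmetric (ab , πab) = K-symmetric ab , Graph.symmetric T πab

    -- By `K-unique` distinct edges of `F` have distinct images, so avoiding an edge survives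
    -- projection.
    project-avoiding : ∀ {a b s t} → F a b → Avoiding F a b s t → Avoiding (Adj T) (π a) (π b) (π s) (π t)
    project-avoiding (ab , _) ((st , πst) , ¬ab) = πst , λ where
      (inj₁ (πs , πt)) → ¬ab (inj₁ (K-unique st ab πs πt))
      (inj₂ (πs , πt)) → ¬ab (inj₂ (K-unique st (K-symmetric ab) πs πt))

    F-bridges : EdgesAreBridges F
    F-bridges ab walk = bridges T-tree (proj₂ ab) (gmap π (project-avoiding ab) walk)

    private
      -- After the last visit to u, an F-walk leaving through uy projects to
      -- a walk in T that avoids the edge π u – π y.
      Left : Fin n → Set
      Left s = s ≡ u ⊎ (∃ λ y → F u y × Star (Avoiding (Adj T) (π u) (π y)) (π y) (π s))

      left-step : ∀ {s t} → Left s → F s t → Left t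
      left-step {t = t} s-left st with t ≟ u
      ... | yes t≡u = inj₁ t≡u
      left-step (inj₁ refl) ut | no _ = inj₂ (_ , ut , ε)
      left-step {s} (inj₂ (y , uy , walk)) st | no t≢u with s ≟ u
      ... | yes refl = inj₂ (_ , st , ε)
      ... | no s≢u   = inj₂ (y , uy , walk ◅◅ return (project-avoiding uy (st , λ where
        (inj₁ (s≡u , _)) → s≢u s≡u
        (inj₂ (_ , t≡u)) → t≢u t≡u)))

      left-walk : ∀ {s t} → Left s → Star F s t → Left t
      left-walk s-left ε          = s-left
      left-walk s-left (e ◅ walk) = left-walk (left-step s-left e) walk

    -- The part of such a walk after its last visit to `u`, starting with an edge `uy`, would
    -- project to a walk from `π y` to `π v`, which is `π u`, bypassing a bridge of `T`.
    separated : ¬ Star F u v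
    separated walk with left-walk (inj₁ refl) walk
    ... | inj₁ v≡u           = u≢v (sym v≡u)
    ... | inj₂ (y , uy , π-walk) = bridges T-tree (proj₂ uy)
      (reverse (avoiding-symmetric (Graph.symmetric T)) (subst (Star _ _) (sym πu≡πv) π-walk))

    -- Lift the walk of `T` from `π z` to `π u` edge by edge. The lift of the next edge starts at
    -- the current vertex unless these two are `u` and `v` in some order, and then the goal is
    -- already reached.
    side : ∀ z → Star F z u ⊎ Star F z v
    side z = go (connected T-tree (π z) (π u)) refl
      where
      go : ∀ {z i} → Star (Adj T) i (π u) → π z ≡ i → Star F z u ⊎ Star F z v
      go ε πz with π-kernel πz
      ... | inj₁ refl              = inj₁ ε
      ... | inj₂ (inj₁ (refl , _)) = inj₁ ε
      ... | inj₂ (inj₂ (refl , _)) = inj₂ ε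
      go (ij ◅ walk) πz with lift-edge T T⊆G ij
      ... | a , b , πa , πb , ab with π-kernel (trans πz (sym πa))
      ... | inj₂ (inj₁ (refl , _)) = inj₁ ε
      ... | inj₂ (inj₂ (refl , _)) = inj₂ ε
      ... | inj₁ refl with go walk πb
      ... | inj₁ bu = inj₁ (ab ◅ bu)
      ... | inj₂ bv = inj₂ (ab ◅ bv)

    -- The edge to be added is `qw`, with `q` the one of `u` and `v` outside the component of `w`.
    -- The last two fields are what `join-tree` asks for.
    record Attachment : Set where
      field
        q         : Fin n
        u-or-v    : q ≡ u ⊎ q ≡ v
        detached  : ¬ Star F q w
        covered   : ∀ z → Star F z w ⊎ Star F z q

    attachment : Attachment
    attachment with side w
    ... | inj₁ w⇝u = record
      { q        = v
      ; u-or-v   = inj₂ refl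
      ; detached = λ v⇝w → separated (reverse F-symmetric (v⇝w ◅◅ w⇝u))
      ; covered  = λ z → [ (λ z⇝u → inj₁ (z⇝u ◅◅ reverse F-symmetric w⇝u)) , inj₂ ]′ (side z)
      }
    ... | inj₂ w⇝v = record
      { q        = u
      ; u-or-v   = inj₁ refl
      ; detached = λ u⇝w → separated (u⇝w ◅◅ w⇝v)
      ; covered  = λ z → [ inj₂ , (λ z⇝v → inj₁ (z⇝v ◅◅ reverse F-symmetric w⇝v)) ]′ (side z)
      }

    open Attachment attachment

    qw : Adj G q w
    qw with u-or-v
    ... | inj₁ q≡u = subst (λ z → Adj G z w) (sym q≡u) uw
    ... | inj₂ q≡v = subst (λ z → Adj G z w) (sym q≡v) vw

    H : Rel (Fin n) 0ℓ
    H = Joined F q w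

    H? : Decidable H
    H? a b = (K? a b ×-dec adj? T (π a) (π b)) ⊎-dec sameEdge? a b q w

    H⊆G : H ⇒ Adj G
    H⊆G (inj₁ ((ab , _) , _))         = ab
    H⊆G (inj₂ (inj₁ (refl , refl))) = qw
    H⊆G (inj₂ (inj₂ (refl , refl))) = G-sym qw

    H-symmetric : Symmetric H
    H-symmetric = joined-symmetric F-symmetric

    H-irreflexive : Irreflexive _≡_ H
    H-irreflexive a≡b e = G-irr a≡b (H⊆G e)

    unfolded : Graph n
    unfolded = fromRel H? H-symmetric H-irreflexive

    H⁺ : H ⇒ Adj unfolded
    H⁺ = fromRel⁺ H? H-symmetric H-irreflexive

    H⁻ : Adj unfolded ⇒ H
    H⁻ = fromRel⁻ H? H-symmetric H-irreflexive

    unfolded⊆G : Adj unfolded ⇒ Adj G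
    unfolded⊆G = H⊆G ∘ H⁻

    unfolded-tree : Tree (Adj unfolded)
    unfolded-tree = tree-resp H⁺ H⁻ (join-tree F-symmetric F-bridges covered detached)

    private
      ¬vw∈F : ¬ F v w
      ¬vw∈F ((_ , ¬both , _) , _) = ¬both (refl , uw)

      vw∈H : q ≡ v → H v w
      vw∈H q≡v = inj₂ (inj₁ (sym q≡v , refl))

    -- With `H⇒F` this describes `F` through `H` without mentioning `q`, so trees that chose
    -- different ends can be compared. If `uw` is in `F`, then `u` is connected to `w`, which forces
    -- `q` to be `v`.
    F⇒H : ∀ {a b} → F a b → H a b × ¬ SameEdge a b v w × (SameEdge a b u w → H v w)
    F⇒H ab = inj₁ ab
           , (λ where
               (inj₁ (refl , refl)) → ¬vw∈F ab
               (inj₂ (refl , refl)) → ¬vw∈F (F-symmetric ab))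
           , (λ where
               (inj₁ (refl , refl)) → uw∈F ab
               (inj₂ (refl , refl)) → uw∈F (F-symmetric ab))
      where
      uw∈F : F u w → H v w
      uw∈F uw with u-or-v
      ... | inj₁ q≡u = contradiction (return (subst (λ z → F z w) (sym q≡u) uw)) detached
      ... | inj₂ q≡v = vw∈H q≡v

    -- The added edge fails the two conditions: either it is `vw`, or it is `uw`, and then `vw` is
    -- in `H` neither through `F` nor as the added edge.
    H⇒F : ∀ {a b} → H a b → ¬ SameEdge a b v w → (SameEdge a b u w → H v w) → F a b
    H⇒F (inj₁ ab) _ _ = ab
    H⇒F (inj₂ ab≡qw) ¬vw uw⇒vw with u-or-v
    ... | inj₂ q≡v = contradiction (subst (λ q → SameEdge _ _ q w) q≡v ab≡qw) ¬vw
    ... | inj₁ q≡u with uw⇒vw (subst (λ q → SameEdge _ _ q w) q≡u ab≡qw)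
    ... | inj₁ vw              = contradiction vw ¬vw∈F
    ... | inj₂ (inj₁ (v≡q , _)) = contradiction (sym (trans v≡q q≡u)) u≢v
    ... | inj₂ (inj₂ (v≡w , _)) = contradiction vw (G-irr v≡w)

  -- Every edge of `T₁` lifts to its forest, and the description of the forest through `H` is
  -- monotone in `H`.
  unfolded-reflects-⇒ : ∀ T₁ T₂ (⊆₁ : Adj T₁ ⇒ Adj folded) (⊆₂ : Adj T₂ ⇒ Adj folded) tree₁ tree₂ →
                        Unfold.unfolded T₁ ⊆₁ tree₁ ≈ Unfold.unfolded T₂ ⊆₂ tree₂ → Adj T₁ ⇒ Adj T₂
  unfolded-reflects-⇒ T₁ T₂ ⊆₁ ⊆₂ tree₁ tree₂ H₁≈H₂ ij with lift-edge T₁ ⊆₁ ij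
  ... | a , b , refl , refl , ab with U₁.F⇒H ab
    where module U₁ = Unfold T₁ ⊆₁ tree₁
  ... | H₁ab , ¬vw , uw⇒vw = proj₂ (U₂.H⇒F (to₂ H₁ab) ¬vw (to₂ ∘ uw⇒vw))
    where
    module U₁ = Unfold T₁ ⊆₁ tree₁
    module U₂ = Unfold T₂ ⊆₂ tree₂
    to₂ : U₁.H ⇒ U₂.H
    to₂ = U₂.H⁻ ∘ ≈⇒adj {G = U₁.unfolded} {H = U₂.unfolded} H₁≈H₂ ∘ U₁.H⁺

  unfold-trees : ∀ {N} → AtLeastTrees N folded → AtLeastTrees N G
  unfold-trees (t , ok , inj) =
      (λ i → U.unfolded i)
    , (λ i → U.unfolded⊆G i , U.unfolded-tree i)
    , λ {i} {j} eq → inj (≈-intro {G = t i} {H = t j}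
        (unfolded-reflects-⇒ (t i) (t j) _ _ (proj₂ (ok i)) (proj₂ (ok j)) eq)
        (unfolded-reflects-⇒ (t j) (t i) _ _ (proj₂ (ok j)) (proj₂ (ok i))
          (≈-sym {G = U.unfolded i} {H = U.unfolded j} eq)))
    where
    module U i = Unfold (t i) (proj₁ (ok i)) (proj₂ (ok i))

-- Hanging a leaf on a tree, and vertices of degree at least two

Branching : ∀ {n} → Graph n → Fin n → Set
Branching T v = ∃₂ λ y z → y ≢ z × Adj T v y × Adj T v z

module Leaf {n} (ℓ : Fin (suc n)) (a : Fin (suc n)) (ℓ≢a : ℓ ≢ a) (T : Graph n) where

  Pushed : Rel (Fin (suc n)) 0ℓ
  Pushed x y = ∃₂ λ i j → punchIn ℓ i ≡ x × punchIn ℓ j ≡ y × Adj T i j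

  pushed? : Decidable Pushed
  pushed? x y = any? λ i → any? λ j → punchIn ℓ i ≟ x ×-dec punchIn ℓ j ≟ y ×-dec adj? T i j

  pushed-symmetric : Symmetric Pushed
  pushed-symmetric (i , j , pi , pj , ij) = j , i , pj , pi , Graph.symmetric T ij

  pushed-irreflexive : Irreflexive _≡_ Pushed
  pushed-irreflexive refl (i , j , refl , pj , ij) =
    Graph.irreflexive T (punchIn-injective ℓ i j (sym pj)) ij

  push : ∀ {i j} → Adj T i j → Pushed (punchIn ℓ i) (punchIn ℓ j)
  push ij = _ , _ , refl , refl , ij

  unpush : ∀ {i j} → Pushed (punchIn ℓ i) (punchIn ℓ j) → Adj T i j
  unpush (i , j , pi , pj , ij) = subst₂ (Adj T) (punchIn-injective ℓ _ _ pi) (punchIn-injective ℓ _ _ pj) ij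

  -- Pushed edges end in the range of `punchIn ℓ`, so the walk never leaves it. The general `S`
  -- allows for walks avoiding an edge.
  unpush-walk : ∀ {S : Rel (Fin (suc n)) 0ℓ} → S ⇒ Pushed → ∀ {i y} → Star S (punchIn ℓ i) y →
                ∃ λ j → punchIn ℓ j ≡ y × Star (λ i j → S (punchIn ℓ i) (punchIn ℓ j)) i j
  unpush-walk S⇒P ε = _ , refl , ε
  unpush-walk S⇒P (e ◅ walk) with S⇒P e
  ... | _ , k , _ , refl , _ with unpush-walk S⇒P walk
  ... | j , pj , k⇝j = j , pj , e ◅ k⇝j

  ℓ-isolated : ∀ {y} → ¬ Pushed ℓ y
  ℓ-isolated (i , _ , pi , _) = punchInᵢ≢i ℓ i pi

  Attached : Rel (Fin (suc n)) 0ℓ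
  Attached = Joined Pushed ℓ a

  attached? : Decidable Attached
  attached? x y = pushed? x y ⊎-dec sameEdge? x y ℓ a

  attached : Graph (suc n)
  attached = fromRel attached? (joined-symmetric pushed-symmetric) (joined-irreflexive ℓ≢a pushed-irreflexive)

  attached⁺ : Attached ⇒ Adj attached
  attached⁺ = fromRel⁺ attached? (joined-symmetric pushed-symmetric) (joined-irreflexive ℓ≢a pushed-irreflexive)

  attached⁻ : Adj attached ⇒ Attached
  attached⁻ = fromRel⁻ attached? (joined-symmetric pushed-symmetric) (joined-irreflexive ℓ≢a pushed-irreflexive)

  attached-push : ∀ {i j} → Adj T i j → Adj attached (punchIn ℓ i) (punchIn ℓ j)
  attached-push = attached⁺ ∘ inj₁ ∘ push

  leaf-edge : Adj attached ℓ a
  leaf-edge = attached⁺ (inj₂ (inj₁ (refl , refl)))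

  leaf-neighbour : ∀ {y} → Adj attached ℓ y → y ≡ a
  leaf-neighbour ℓy with attached⁻ ℓy
  ... | inj₁ e                  = contradiction e ℓ-isolated
  ... | inj₂ (inj₁ (_ , y≡a)) = y≡a
  ... | inj₂ (inj₂ (ℓ≡a , _)) = contradiction ℓ≡a ℓ≢a

  attached-pull : ∀ {i j} → Adj attached (punchIn ℓ i) (punchIn ℓ j) → Adj T i j
  attached-pull {i} {j} e with attached⁻ e
  ... | inj₁ e                = unpush e
  ... | inj₂ (inj₁ (pi , _)) = contradiction pi (punchInᵢ≢i ℓ i)
  ... | inj₂ (inj₂ (_ , pj)) = contradiction pj (punchInᵢ≢i ℓ j)

  attached-pull-≢a : ∀ {i y} → punchIn ℓ i ≢ a → Adj attached (punchIn ℓ i) y → ∃ λ j → punchIn ℓ j ≡ y × Adj T i j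
  attached-pull-≢a {i} ≢a e with attached⁻ e
  ... | inj₁ (i′ , j , pi , pj , ij) = j , pj , subst (λ i → Adj T i j) (punchIn-injective ℓ i′ i pi) ij
  ... | inj₂ (inj₁ (pi , _))       = contradiction pi (punchInᵢ≢i ℓ i)
  ... | inj₂ (inj₂ (pi , _))       = contradiction pi ≢a

  branching-push : ∀ {i} → Branching T i → Branching attached (punchIn ℓ i)
  branching-push (y , z , y≢z , iy , iz) =
    punchIn ℓ y , punchIn ℓ z , y≢z ∘ punchIn-injective ℓ y z , attached-push iy , attached-push iz

  branching-pull : ∀ {i} → punchIn ℓ i ≢ a → Branching attached (punchIn ℓ i) → Branching T i
  branching-pull ≢a (_ , _ , y≢z , iy , iz) with attached-pull-≢a ≢a iy | attached-pull-≢a ≢a iz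
  ... | y , refl , iy | z , refl , iz = y , z , y≢z ∘ cong (punchIn ℓ) , iy , iz

  leaf-¬branching : ¬ Branching attached ℓ
  leaf-¬branching (_ , _ , y≢z , ℓy , ℓz) = y≢z (trans (leaf-neighbour ℓy) (sym (leaf-neighbour ℓz)))

  a-branching : ∃ (Adj T (punchOut ℓ≢a)) → Branching attached a
  a-branching (y , ay) = ℓ , punchIn ℓ y , (punchInᵢ≢i ℓ y ∘ sym) , Graph.symmetric attached leaf-edge ,
    subst (λ x → Adj attached x (punchIn ℓ y)) (punchIn-punchOut ℓ≢a) (attached-push ay)

  -- `join-tree` applies with the isolated vertex `ℓ` as one of the two components.
  attached-tree : Tree (Adj T) → Tree (Adj attached)
  attached-tree T-tree = tree-resp attached⁺ attached⁻
    (join-tree pushed-symmetric pushed-bridges covered λ where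
      ε       → ℓ≢a refl
      (e ◅ _) → ℓ-isolated e)
    where
    a′ : Fin n
    a′ = punchOut ℓ≢a

    covered : ∀ z → Star Pushed z a ⊎ Star Pushed z ℓ
    covered z with ℓ ≟ z
    ... | yes refl = inj₂ ε
    ... | no ℓ≢z   = inj₁ (subst₂ (Star Pushed) (punchIn-punchOut ℓ≢z) (punchIn-punchOut ℓ≢a)
      (gmap (punchIn ℓ) push (connected T-tree (punchOut ℓ≢z) a′)))

    pushed-bridges : EdgesAreBridges Pushed
    pushed-bridges (i , j , refl , refl , ij) walk with unpush-walk proj₁ walk
    ... | j′ , pj , i⇝j with punchIn-injective ℓ j′ j pj
    ... | refl = bridges T-tree ij (map avoid i⇝j)
      where
      avoid : ∀ {s t} → Avoiding Pushed (punchIn ℓ i) (punchIn ℓ j) (punchIn ℓ s) (punchIn ℓ t) →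
              Avoiding (Adj T) i j s t
      avoid (e , ¬ij) = unpush e , λ where
        (inj₁ (refl , refl)) → ¬ij (inj₁ (refl , refl))
        (inj₂ (refl , refl)) → ¬ij (inj₂ (refl , refl))

-- Once the leaf is known, `a` is its only neighbour and `T` is what its deletion leaves.
attached-injective : ∀ {n} {ℓ ℓ′ a a′ : Fin (suc n)} (ℓ≢a : ℓ ≢ a) (ℓ′≢a′ : ℓ′ ≢ a′)
                     (T T′ : Graph n) → ℓ ≡ ℓ′ →
                     Leaf.attached ℓ a ℓ≢a T ≈ Leaf.attached ℓ′ a′ ℓ′≢a′ T′ → a ≡ a′ × T ≈ T′
attached-injective {ℓ = ℓ} {a = a} {a′ = a′} ℓ≢a ℓ≢a′ T T′ refl eq =
    L′.leaf-neighbour (to L.leaf-edge)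
  , ≈-intro {G = T} {H = T′} (L′.attached-pull ∘ to ∘ L.attached-push) (L.attached-pull ∘ from ∘ L′.attached-push)
  where
  module L = Leaf ℓ a ℓ≢a T
  module L′ = Leaf ℓ a′ ℓ≢a′ T′
  to : Adj L.attached ⇒ Adj L′.attached
  to = ≈⇒adj {G = L.attached} {H = L′.attached} eq
  from : Adj L′.attached ⇒ Adj L.attached
  from = ≈⇒adj {G = L′.attached} {H = L.attached} (≈-sym {G = L.attached} {H = L′.attached} eq)

-- The smallest value missed by a finite sequence

Hit : ∀ {m n} → (Fin m → Fin n) → Fin n → Set
Hit s v = ∃ λ i → s i ≡ v

hit? : ∀ {m n} (s : Fin m → Fin n) v → Dec (Hit s v)
hit? s v = any? λ i → s i ≟ v

-- Pigeonhole: choosing a preimage of each value would be an injection from `Fin n` to `Fin m`.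
¬all-hit : ∀ {m n} → m < n → (s : Fin m → Fin n) → ¬ (∀ v → Hit s v)
¬all-hit m<n s all-hit = <⇒≱ m<n (injective⇒≤ {f = proj₁ ∘ all-hit} λ {v} {v′} eq →
  trans (sym (proj₂ (all-hit v))) (trans (cong s eq) (proj₂ (all-hit v′))))

opaque
  leastMissing : ∀ {m n} → m < n → (s : Fin m → Fin n) →
                 ∃ λ v → ¬ Hit s v × ((j : Fin′ v) → Hit s (inject j))
  leastMissing m<n s = ¬∀⟶∃¬-smallest _ (Hit s) (hit? s) (¬all-hit m<n s)

missing : ∀ {m n} → m < n → (Fin m → Fin n) → Fin n
missing m<n s = proj₁ (leastMissing m<n s)

missing-¬hit : ∀ {m n} (m<n : m < n) (s : Fin m → Fin n) → ¬ Hit s (missing m<n s)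
missing-¬hit m<n s = proj₁ (proj₂ (leastMissing m<n s))

missing-least : ∀ {m n} (m<n : m < n) (s : Fin m → Fin n) {v} → v Fin.< missing m<n s → Hit s v
missing-least m<n s {v} v<ℓ =
  subst (Hit s) (toℕ-injective (trans (toℕ-inject _) (toℕ-fromℕ< v<ℓ)))
    (proj₂ (proj₂ (leastMissing m<n s)) (fromℕ< v<ℓ))

-- If the missing values differed, the smaller would be hit by the sequence missing the larger,
-- hence by both.
missing-cong : ∀ {m n} (m<n : m < n) (s s′ : Fin m → Fin n) →
               (∀ v → Hit s v → Hit s′ v) → (∀ v → Hit s′ v → Hit s v) → missing m<n s ≡ missing m<n s′
missing-cong m<n s s′ s⇒s′ s′⇒s with <-cmp (missing m<n s) (missing m<n s′)
... | tri< ℓ<ℓ′ _ _ = contradiction (s′⇒s _ (missing-least m<n s′ ℓ<ℓ′)) (missing-¬hit m<n s)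
... | tri≈ _ eq _   = eq
... | tri> _ _ ℓ′<ℓ = contradiction (s⇒s′ _ (missing-least m<n s ℓ′<ℓ)) (missing-¬hit m<n s′)

-- Prüfer decoding and its injectivity

distinct-symmetric : ∀ {A : Set} → Symmetric (_≢_ {A = A})
distinct-symmetric x≢y y≡x = x≢y (sym y≡x)

complete₂ : Graph 2
complete₂ = fromRel (λ x y → ¬? (x ≟ y)) distinct-symmetric (λ x≡y x≢y → x≢y x≡y)

complete₂⁻ : ∀ {u v} → Adj complete₂ u v → u ≢ v
complete₂⁻ = fromRel⁻ (λ x y → ¬? (x ≟ y)) distinct-symmetric (λ x≡y x≢y → x≢y x≡y)

complete₂⁺ : ∀ {u v} → u ≢ v → Adj complete₂ u v
complete₂⁺ = fromRel⁺ (λ x y → ¬? (x ≟ y)) distinct-symmetric (λ x≡y x≢y → x≢y x≡y)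

third-repeats : ∀ {u v w : Fin 2} → u ≢ v → u ≢ w → v ≡ w
third-repeats {zero}     {zero}                u≢v _   = contradiction refl u≢v
third-repeats {zero}     {suc zero} {zero}     _   u≢w = contradiction refl u≢w
third-repeats {zero}     {suc zero} {suc zero} _   _   = refl
third-repeats {suc zero} {zero}     {zero}     _   _   = refl
third-repeats {suc zero} {zero}     {suc zero} _   u≢w = contradiction refl u≢w
third-repeats {suc zero} {suc zero}            u≢v _   = contradiction refl u≢v

complete₂-tree : Tree (Adj complete₂)
complete₂-tree = record { connected = conn ; bridges = bridge }
  where
  conn : ∀ u v → Star (Adj complete₂) u v
  conn u v with u ≟ v
  ... | yes refl = ε
  ... | no u≢v   = return (complete₂⁺ u≢v)

  bridge : EdgesAreBridges (Adj complete₂)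
  bridge ab ε = complete₂⁻ ab refl
  bridge ab ((ac , ¬ab) ◅ _) = ¬ab (inj₁ (refl , third-repeats (complete₂⁻ ac) (complete₂⁻ ab)))

¬branching₂ : ∀ {v} → ¬ Branching complete₂ v
¬branching₂ (_ , _ , y≢z , vy , vz) = y≢z (third-repeats (complete₂⁻ vy) (complete₂⁻ vz))

-- One step of Prüfer decoding: ℓ is the smallest leaf of the tree encoded by s
-- and s zero is its neighbour.
module Step {m} (s : Fin (suc m) → Fin (3 + m)) where

  ℓ : Fin (3 + m)
  ℓ = missing (m≤n⇒m≤1+n ≤-refl) s

  ℓ≢s : ∀ i → ℓ ≢ s i
  ℓ≢s i ℓ≡si = missing-¬hit (m≤n⇒m≤1+n ≤-refl) s (i , sym ℓ≡si)

  rest : Fin m → Fin (2 + m)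
  rest i = punchOut (ℓ≢s (suc i))

-- A code is two shorter than the number of vertices, so the empty code stands for the single edge.
decode : ∀ m → (Fin m → Fin (2 + m)) → Graph (2 + m)
decode zero    s = complete₂
decode (suc m) s = Leaf.attached ℓ (s zero) (ℓ≢s zero) (decode m rest)
  where open Step s

decode-tree : ∀ m s → Tree (Adj (decode m s))
decode-tree zero    s = complete₂-tree
decode-tree (suc m) s = Leaf.attached-tree ℓ (s zero) (ℓ≢s zero) (decode m rest) (decode-tree m rest)
  where open Step s

tree-neighbour : ∀ {n} (T : Graph (2 + n)) → Tree (Adj T) → ∀ v → ∃ (Adj T v)
tree-neighbour T tree v with connected tree v (punchIn v zero) | punchInᵢ≢i v zero
... | walk | ≢v = go walk ≢v
  where
  go : ∀ {w} → Star (Adj T) v w → w ≢ v → ∃ (Adj T v)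
  go ε       w≢v = contradiction refl w≢v
  go (e ◅ _) _   = _ , e

-- In a Prüfer code a vertex of degree d occurs d - 1 times; this and `branching⇒hit` retain only
-- which vertices occur. The entry `s zero` gains the neighbour `ℓ` besides one it has in the
-- smaller tree; later entries branch there already.
hit⇒branching : ∀ m s v → Hit s v → Branching (decode m s) v
hit⇒branching (suc m) s _ (zero , refl) =
  a-branching (tree-neighbour (decode m rest) (decode-tree m rest) (punchOut (ℓ≢s zero)))
  where
  open Step s
  open Leaf ℓ (s zero) (ℓ≢s zero) (decode m rest)
hit⇒branching (suc m) s _ (suc i , refl) =
  subst (Branching attached) (punchIn-punchOut (ℓ≢s (suc i))) (branching-push (hit⇒branching m rest _ (i , refl)))
  where
  open Step s
  open Leaf ℓ (s zero) (ℓ≢s zero) (decode m rest)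

-- A vertex other than `ℓ` and `s zero` has the same neighbours in the smaller tree, so induction
-- finds it in the tail.
branching⇒hit : ∀ m s v → Branching (decode m s) v → Hit s v
branching⇒hit zero    s v b = contradiction b ¬branching₂
branching⇒hit (suc m) s v b = by-cases (ℓ ≟ v) (s zero ≟ v)
  where
  open Step s
  open Leaf ℓ (s zero) (ℓ≢s zero) (decode m rest)
  by-cases : Dec (ℓ ≡ v) → Dec (s zero ≡ v) → Hit s v
  by-cases _         (yes a≡v) = zero , a≡v
  by-cases (yes ℓ≡v) (no _)    = contradiction (subst (Branching attached) (sym ℓ≡v) b) leaf-¬branching
  by-cases (no ℓ≢v)  (no a≢v)  =
    suc (proj₁ rest-hit) , punchOut-injective (ℓ≢s (suc (proj₁ rest-hit))) ℓ≢v (proj₂ rest-hit)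
    where
    rest-hit : Hit rest (punchOut ℓ≢v)
    rest-hit = branching⇒hit m rest (punchOut ℓ≢v) (branching-pull
      (λ eq → a≢v (trans (sym eq) (punchIn-punchOut ℓ≢v)))
      (subst (Branching attached) (sym (punchIn-punchOut ℓ≢v)) b))

branching-resp : ∀ {n} {T T′ : Graph n} → T ≈ T′ → ∀ {v} → Branching T v → Branching T′ v
branching-resp {T = T} {T′} eq (y , z , y≢z , vy , vz) =
  y , z , y≢z , ≈⇒adj {G = T} {H = T′} eq vy , ≈⇒adj {G = T} {H = T′} eq vz

decode-hit : ∀ m s s′ → decode m s ≈ decode m s′ → ∀ v → Hit s v → Hit s′ v
decode-hit m s s′ eq v =
  branching⇒hit m s′ v ∘ branching-resp {T = decode m s} {T′ = decode m s′} eq ∘ hit⇒branching m s v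

-- Equal trees have the same branching vertices, so their codes have the same values and the same
-- smallest leaf. Removing that leaf yields the first entry and a smaller instance.
decode-injective : ∀ m s s′ → decode m s ≈ decode m s′ → ∀ i → s i ≡ s′ i
decode-injective (suc m) s s′ eq = λ where
    zero    → proj₁ head-and-tail
    -- The tail is compared after renumbering around the leaf; `punchIn` undoes this, once the
    -- leaves are known to agree.
    (suc i) → trans (sym (punchIn-punchOut (S.ℓ≢s (suc i))))
                (trans (cong₂ punchIn ℓ≡ℓ′ (decode-injective m S.rest S′.rest (proj₂ head-and-tail) i))
                  (punchIn-punchOut (S′.ℓ≢s (suc i))))
  where
  module S = Step s
  module S′ = Step s′
  ℓ≡ℓ′ : S.ℓ ≡ S′.ℓ
  ℓ≡ℓ′ = missing-cong _ s s′ (decode-hit (suc m) s s′ eq)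
           (decode-hit (suc m) s′ s (≈-sym {G = decode (suc m) s} {H = decode (suc m) s′} eq))
  head-and-tail : s zero ≡ s′ zero × decode m S.rest ≈ decode m S′.rest
  head-and-tail = attached-injective (S.ℓ≢s zero) (S′.ℓ≢s zero) (decode m S.rest) (decode m S′.rest) ℓ≡ℓ′ eq

-- Cayley's lower bound for complete graphs

funToFin-cong : ∀ {m n} {f g : Fin m → Fin n} → (∀ i → f i ≡ g i) → funToFin f ≡ funToFin g
funToFin-cong {zero}  f≗g = refl
funToFin-cong {suc m} f≗g = cong₂ combine (f≗g zero) (funToFin-cong (f≗g ∘ suc))

finToFun-injective : ∀ {m n} {i j : Fin (n ^ m)} → (∀ k → finToFun i k ≡ finToFun j k) → i ≡ j
finToFun-injective {m} {n} {i} {j} eq =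
  trans (sym (funToFin-finToFin {m} {n} i)) (trans (funToFin-cong {m} {n} eq) (funToFin-finToFin {m} {n} j))

Complete : ∀ {n} → Graph n → Set
Complete G = ∀ {u v} → u ≢ v → Adj G u v

cayley : ∀ {n} (G : Graph n) → Complete G → 0 < n → AtLeastTrees (n ^ (n ∸ 2)) G
-- Truncated subtraction makes the exponent `0`, so one tree is wanted: `G` itself.
cayley {suc zero} G _ _ = (λ _ → G) , (λ _ → id , tree) , λ { {zero} {zero} _ → refl }
  where
  tree : Tree (Adj G)
  tree = record
    { connected = λ { zero zero → ε }
    ; bridges   = λ { {zero} {zero} e → contradiction e (Graph.irreflexive G refl) }
    }
cayley {suc (suc m)} G complete _ =
    (λ i → decode m (finToFun i))
  , (λ i → (λ e → complete λ u≡v → Graph.irreflexive (decode m (finToFun i)) u≡v e) , decode-tree m (finToFun i))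
  , λ eq → finToFun-injective {m} {2 + m} (decode-injective m _ _ eq)

-- The quotient map merging `v` into `u`, as required by `Fold`

identify : ∀ {n} {u v : Fin (suc n)} → v ≢ u → Fin (suc n) → Fin n
identify {v = v} v≢u z with v ≟ z
... | yes _  = punchOut v≢u
... | no v≢z = punchOut v≢z

identify-source : ∀ {n} {u v : Fin (suc n)} (v≢u : v ≢ u) → identify v≢u v ≡ punchOut v≢u
identify-source {v = v} v≢u with v ≟ v
... | yes _  = refl
... | no v≢v = contradiction refl v≢v

identify-other : ∀ {n} {u v z : Fin (suc n)} (v≢u : v ≢ u) (v≢z : v ≢ z) → identify v≢u z ≡ punchOut v≢z
identify-other {v = v} {z} v≢u v≢z with v ≟ z
... | yes v≡z = contradiction v≡z v≢z
... | no _    = punchOut-cong v refl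

identify-surjective : ∀ {n} {u v : Fin (suc n)} (v≢u : v ≢ u) i → ∃ λ z → identify v≢u z ≡ i
identify-surjective {v = v} v≢u i =
  punchIn v i , trans (identify-other v≢u (punchInᵢ≢i v i ∘ sym)) (punchOut-punchIn v)

identify-kernel : ∀ {n} {u v : Fin (suc n)} (v≢u : v ≢ u) {a b} → identify v≢u a ≡ identify v≢u b →
                  a ≡ b ⊎ SameEdge a b u v
identify-kernel {v = v} v≢u {a} {b} eq with v ≟ a | v ≟ b
... | yes v≡a | yes v≡b = inj₁ (trans (sym v≡a) v≡b)
... | yes v≡a | no v≢b  = inj₂ (inj₂ (sym v≡a , sym (punchOut-injective v≢u v≢b eq)))
... | no v≢a  | yes v≡b = inj₂ (inj₁ (punchOut-injective v≢a v≢u eq , sym v≡b))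
... | no v≢a  | no v≢b  = inj₁ (punchOut-injective v≢a v≢b eq)

-- Reduction to complete graphs by folding induced paths on three vertices

Cherry : ∀ {n} → Graph n → Set
Cherry G = ∃₂ λ u v → ∃ λ w → u ≢ v × ¬ Adj G u v × Adj G u w × Adj G v w

cherry? : ∀ {n} (G : Graph n) → Dec (Cherry G)
cherry? G = any? λ u → any? λ v → any? λ w → ¬? (u ≟ v) ×-dec ¬? (adj? G u v) ×-dec adj? G u w ×-dec adj? G v w

-- By induction along the walk its second vertex is `v` or adjacent to `v`; in the latter case the
-- lack of a cherry closes the triangle.
cherry-free⇒complete : ∀ {n} (G : Graph n) → (∀ u v → Star (Adj G) u v) → ¬ Cherry G → Complete G
cherry-free⇒complete G conn ¬cherry {u} {v} u≢v = go (conn u v) u≢v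
  where
  go : ∀ {u v} → Star (Adj G) u v → u ≢ v → Adj G u v
  go ε u≢u = contradiction refl u≢u
  go {u} {v} (_◅_ {j = w} uw walk) u≢v with w ≟ v | adj? G u v
  ... | yes refl | _      = uw
  ... | no _     | yes uv = uv
  ... | no w≢v   | no ¬uv =
    contradiction (u , v , w , u≢v , ¬uv , uw , Graph.symmetric G (go walk w≢v)) ¬cherry

-- With at least as many colours as vertices, each vertex can have its own.
¬colourable⇒< : ∀ {n k} (G : Graph n) → ¬ Colourable k G → k < n
¬colourable⇒< G ¬col = ≰⇒> λ n≤k → ¬col
  ( (λ v → inject≤ v n≤k)
  , λ u v uv eq → Graph.irreflexive G (inject≤-injective n≤k n≤k u v eq) uv)

-- `suc k` is the chromatic number, so `k ∸ 1` is the exponent `suc k ∸ 2`. Monotonicity in the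
-- exponent requires the positive base `n`.
power-bound : ∀ k n → suc k ≤ n → suc k ^ (k ∸ 1) ≤ n ^ (n ∸ 2)
power-bound k n@(suc _) k<n =
  ≤-trans (^-monoˡ-≤ (k ∸ 1) k<n) (^-monoʳ-≤ n (∸-monoˡ-≤ 2 k<n))

-- Induction on the number of vertices. The invariant is non-colourability, because folding may
-- raise the chromatic number but never lowers it.
manyTrees : ∀ n k (G : Graph n) → 0 < n → (∀ u v → Star (Adj G) u v) → ¬ Colourable k G →
            AtLeastTrees (suc k ^ (k ∸ 1)) G
manyTrees (suc n) k G 0<n conn ¬col with cherry? G
... | no ¬cherry = atLeast-mono {G = G} (power-bound k (suc n) (¬colourable⇒< G ¬col))
                     (cayley G (cherry-free⇒complete G conn ¬cherry) 0<n)
... | yes (u , v , w , u≢v , ¬uv , uw , vw) =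
  -- The image of `u` witnesses that the folded graph has a vertex.
  unfold-trees (manyTrees n k folded (0<Fin (identify v≢u u)) (folded-connected conn) (¬col ∘ folded-colourable))
  where
  v≢u : v ≢ u
  v≢u = u≢v ∘ sym
  open Fold G (identify v≢u) (identify-surjective v≢u)
    (trans (identify-other v≢u v≢u) (sym (identify-source v≢u)))
    (identify-kernel v≢u) u≢v ¬uv uw vw
  0<Fin : ∀ {m} → Fin m → 0 < m
  0<Fin zero    = s≤s z≤n
  0<Fin (suc _) = s≤s z≤n

theorem1 : (k : ℕ) → 1 ≤ k → (n : ℕ) (G : Graph n) → Connected G → Chromatic k G → AtLeast (k ^ (k ∸ 2)) SpanningTreesIn G
theorem1 (suc k) _ n G (0<n , conn) (_ , ¬col) = atLeastTrees⇒spanning {G = G} 0<n (manyTrees n k G 0<n conn ¬col)
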